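{- Let $L$ be any one of the sequent calculi $\mathrm{LJ}^+$, $\mathrm{sC}$, $\mathrm{sC3}$, $\mathrm{sMC}$, $\mathrm{sCN}$. For every formula $\alpha$ and every finite set $\Gamma$ of formulas (in the language of $L$), the sequent $\alpha,\Gamma\Rightarrow\alpha$ is provable in $L$.
   Context: Formulas of $\mathrm{sC},\mathrm{sC3},\mathrm{sMC},\mathrm{sCN}$ are built from countably many propositional variables $p,q,\dots$ using the binary connectives $\land,\lor,\to$ and the unary connective $\sim$; the language of $\mathrm{LJ}^+$ (positive intuitionistic logic) has only $\land,\lor,\to$ and no $\sim$. A sequent is an expression $\Gamma\Rightarrow\gamma$ with $\Gamma$ a finite (possibly empty) set of formulas and $\gamma$ a single formula; $\alpha,\Gamma$ means $\{\alpha\}\cup\Gamma$ and $\Gamma,\Delta$ means $\Gamma\cup\Delta$. Below, $p$ is any propositional variable, $\alpha,\beta,\gamma$ any formulas, $\Gamma,\Delta,\Sigma$ any finite sets of formulas. $\mathrm{LJ}^+$ has initial sequents (init1) $p,\Gamma\Rightarrow p$ and rules: (cut): from $\Gamma\Rightarrow\alpha$ and $\alpha,\Sigma\Rightarrow\gamma$ infer $\Gamma,\Sigma\Rightarrow\gamma$. ($\to$left): from $\Gamma\Rightarrow\alpha$ and $\beta,\Delta\Rightarrow\gamma$ infer $\alpha\to\beta,\Gamma,\Delta\Rightarrow\gamma$. ($\to$right): from $\alpha,\Gamma\Rightarrow\beta$ infer $\Gamma\Rightarrow\alpha\to\beta$. ($\land$left): from $\alpha,\beta,\Gamma\Rightarrow\gamma$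 infer $\alpha\land\beta,\Gamma\Rightarrow\gamma$. ($\land$right): from $\Gamma\Rightarrow\alpha$ and $\Gamma\Rightarrow\beta$ infer $\Gamma\Rightarrow\alpha\land\beta$. ($\lor$left): from $\alpha,\Gamma\Rightarrow\gamma$ and $\beta,\Gamma\Rightarrow\gamma$ infer $\alpha\lor\beta,\Gamma\Rightarrow\gamma$. ($\lor$right1), ($\lor$right2): from $\Gamma\Rightarrow\alpha$ (respectively $\Gamma\Rightarrow\beta$) infer $\Gamma\Rightarrow\alpha\lor\beta$. $\mathrm{sC}$ is $\mathrm{LJ}^+$ (over the full language) plus initial sequents (init2) $\sim p,\Gamma\Rightarrow\sim p$ and rules: ($\sim$left): from $\alpha,\Gamma\Rightarrow\gamma$ infer $\sim\sim\alpha,\Gamma\Rightarrow\gamma$. ($\sim$right): from $\Gamma\Rightarrow\alpha$ infer $\Gamma\Rightarrow\sim\sim\alpha$. ($\sim\to$left): from $\Gamma\Rightarrow\alpha$ and $\sim\beta,\Delta\Rightarrow\gamma$ infer $\sim(\alpha\to\beta),\Gamma,\Delta\Rightarrow\gamma$. ($\sim\to$right): from $\alpha,\Gamma\Rightarrow\sim\beta$ infer $\Gamma\Rightarrow\sim(\alpha\to\beta)$. ($\sim\land$left): from $\sim\alpha,\Gamma\Rightarrow\gamma$ and $\sim\beta,\Gamma\Rightarrow\gamma$ infer $\sim(\alpha\land\beta),\Gamma\Rightarrow\gamma$. ($\sim\land$right1), ($\sim\land$right2): from $\Gamma\Rightarrow\sim\alpha$ (respectively $\Gamma\Rightarrow\sim\beta$)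 infer $\Gamma\Rightarrow\sim(\alpha\land\beta)$. ($\sim\lor$left): from $\sim\alpha,\sim\beta,\Gamma\Rightarrow\gamma$ infer $\sim(\alpha\lor\beta),\Gamma\Rightarrow\gamma$. ($\sim\lor$right): from $\Gamma\Rightarrow\sim\alpha$ and $\Gamma\Rightarrow\sim\beta$ infer $\Gamma\Rightarrow\sim(\alpha\lor\beta)$. Additional rules: (ex-middle): from $\sim\alpha,\Gamma\Rightarrow\gamma$ and $\alpha,\Gamma\Rightarrow\gamma$ infer $\Gamma\Rightarrow\gamma$. (Peirce): from $\alpha\to\beta,\Gamma\Rightarrow\alpha$ infer $\Gamma\Rightarrow\alpha$. $\mathrm{sC3}=\mathrm{sC}+$(ex-middle); $\mathrm{sMC}=\mathrm{sC}+$(Peirce); $\mathrm{sCN}=\mathrm{sC3}+$(Peirce). -}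

module Defs where

open import Data.Nat using (ℕ)
open import Data.List using (List; _∷_; _++_)
open import Data.List.Relation.Binary.BagAndSetEquality using (_∼[_]_; set)

data Language : Set where
  positive full : Language

infix  9 ∼_
infixr 8 _∧_
infixr 7 _∨_
infixr 6 _⊃_

-- `_⊃_` is the implication connective, since `→` is reserved in Agda.
data Formula : Language → Set where
  var         : ∀ {ℓ} → ℕ → Formula ℓ
  _∧_ _∨_ _⊃_ : ∀ {ℓ} → Formula ℓ → Formula ℓ → Formula ℓ
  ∼_          : Formula full → Formula full

data Calculus : Language → Set where
  LJ⁺             : Calculus positive
  sC sC3 sMC sCN  : Calculus full

data HasExMiddle : Calculus full → Set where
  sC3 : HasExMiddle sC3
  sCN : HasExMiddle sCN

data HasPeirce : Calculus full → Set where
  sMC : HasPeirce sMC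
  sCN : HasPeirce sCN

private variable
  ℓ       : Language
  L       : Calculus ℓ
  C       : Calculus full
  p       : ℕ
  α β γ   : Formula ℓ
  Γ Δ Σ   : List (Formula ℓ)

infix 4 _⊢_⇒_

-- `L ⊢ Γ ⇒ γ` is the type of derivations of the sequent Γ ⇒ γ in L.
-- Antecedents are finite sets, represented by lists up to having the same
-- elements: `_∷_` is insertion and `_++_` is union.  The constructor
-- `same-set` is not a rule of the calculi; it identifies the lists that
-- represent one finite set.  It does not add any element, so it is not
-- weakening.
data _⊢_⇒_ : Calculus ℓ → List (Formula ℓ) → Formula ℓ → Set where

  same-set : Γ ∼[ set ] Δ → L ⊢ Γ ⇒ γ → L ⊢ Δ ⇒ γ

  init1  : L ⊢ var p ∷ Γ ⇒ var p
  cut    : L ⊢ Γ ⇒ α → L ⊢ α ∷ Σ ⇒ γ → L ⊢ Γ ++ Σ ⇒ γ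
  ⊃left  : L ⊢ Γ ⇒ α → L ⊢ β ∷ Δ ⇒ γ → L ⊢ α ⊃ β ∷ Γ ++ Δ ⇒ γ
  ⊃right : L ⊢ α ∷ Γ ⇒ β → L ⊢ Γ ⇒ α ⊃ β
  ∧left  : L ⊢ α ∷ β ∷ Γ ⇒ γ → L ⊢ α ∧ β ∷ Γ ⇒ γ
  ∧right : L ⊢ Γ ⇒ α → L ⊢ Γ ⇒ β → L ⊢ Γ ⇒ α ∧ β
  ∨left  : L ⊢ α ∷ Γ ⇒ γ → L ⊢ β ∷ Γ ⇒ γ → L ⊢ α ∨ β ∷ Γ ⇒ γ
  ∨right1 : L ⊢ Γ ⇒ α → L ⊢ Γ ⇒ α ∨ β
  ∨right2 : L ⊢ Γ ⇒ β → L ⊢ Γ ⇒ α ∨ β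

  -- The calculi over the full language are exactly the extensions of sC.
  init2    : C ⊢ ∼ var p ∷ Γ ⇒ ∼ var p
  ∼left    : C ⊢ α ∷ Γ ⇒ γ → C ⊢ ∼ (∼ α) ∷ Γ ⇒ γ
  ∼right   : C ⊢ Γ ⇒ α → C ⊢ Γ ⇒ ∼ (∼ α)
  ∼⊃left   : C ⊢ Γ ⇒ α → C ⊢ ∼ β ∷ Δ ⇒ γ → C ⊢ ∼ (α ⊃ β) ∷ Γ ++ Δ ⇒ γ
  ∼⊃right  : C ⊢ α ∷ Γ ⇒ ∼ β → C ⊢ Γ ⇒ ∼ (α ⊃ β)
  ∼∧left   : C ⊢ ∼ α ∷ Γ ⇒ γ → C ⊢ ∼ β ∷ Γ ⇒ γ → C ⊢ ∼ (α ∧ β) ∷ Γ ⇒ γ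
  ∼∧right1 : C ⊢ Γ ⇒ ∼ α → C ⊢ Γ ⇒ ∼ (α ∧ β)
  ∼∧right2 : C ⊢ Γ ⇒ ∼ β → C ⊢ Γ ⇒ ∼ (α ∧ β)
  ∼∨left   : C ⊢ ∼ α ∷ ∼ β ∷ Γ ⇒ γ → C ⊢ ∼ (α ∨ β) ∷ Γ ⇒ γ
  ∼∨right  : C ⊢ Γ ⇒ ∼ α → C ⊢ Γ ⇒ ∼ β → C ⊢ Γ ⇒ ∼ (α ∨ β)

  ex-middle : HasExMiddle C → C ⊢ ∼ α ∷ Γ ⇒ γ → C ⊢ α ∷ Γ ⇒ γ → C ⊢ Γ ⇒ γ
  Peirce    : HasPeirce C → C ⊢ α ⊃ β ∷ Γ ⇒ α → C ⊢ Γ ⇒ α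

{-# OPTIONS --safe #-}
module Submission where

open import Defs
open import Data.List using (List; []; _∷_)
open import Data.List.Relation.Binary.BagAndSetEquality using (bag-=⇒; ↭⇒∼bag)
open import Data.List.Relation.Binary.Permutation.Propositional using (↭-refl; ↭-swap)

exchange : ∀ {ℓ} {L : Calculus ℓ} {α β γ : Formula ℓ} {Γ : List (Formula ℓ)} →
           L ⊢ α ∷ β ∷ Γ ⇒ γ → L ⊢ β ∷ α ∷ Γ ⇒ γ
exchange {α = α} {β} = same-set (bag-=⇒ (↭⇒∼bag (↭-swap α β ↭-refl)))

-- The rules for negated compounds have premises about negated components, so
-- the induction on α treats α and ∼ α simultaneously.
mutual
  identity : ∀ {ℓ} (L : Calculus ℓ) (α : Formula ℓ) (Γ : List (Formula ℓ)) → L ⊢ α ∷ Γ ⇒ α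
  identity L (var p) Γ = init1
  identity L (α ∧ β) Γ =
    ∧left (∧right (identity L α (β ∷ Γ)) (exchange (identity L β (α ∷ Γ))))
  identity L (α ∨ β) Γ = ∨left (∨right1 (identity L α Γ)) (∨right2 (identity L β Γ))
  identity L (α ⊃ β) Γ = ⊃right (exchange (⊃left (identity L α []) (identity L β Γ)))
  identity L (∼ α)   Γ = ∼identity L α Γ

  ∼identity : (C : Calculus full) (α : Formula full) (Γ : List (Formula full)) →
              C ⊢ ∼ α ∷ Γ ⇒ ∼ α
  ∼identity C (var p) Γ = init2
  ∼identity C (α ∧ β) Γ = ∼∧left (∼∧right1 (∼identity C α Γ)) (∼∧right2 (∼identity C β Γ))
  ∼identity C (α ∨ β) Γ =
    ∼∨left (∼∨right (∼identity C α (∼ β ∷ Γ)) (exchange (∼identity C β (∼ α ∷ Γ))))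
  ∼identity C (α ⊃ β) Γ = ∼⊃right (exchange (∼⊃left (identity C α []) (∼identity C β Γ)))
  ∼identity C (∼ α)   Γ = ∼left (∼right (identity C α Γ))

proposition2p3 : ∀ {ℓ} (L : Calculus ℓ) (α : Formula ℓ) (Γ : List (Formula ℓ)) → L ⊢ α ∷ Γ ⇒ α
proposition2p3 = identity
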